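{- Let $\mathscr{C}_n$ be the set of Catalan words of length $2n$. For every integer $m\ge 2$ and every $0\le r\le m-1$, $$\lim_{n\to\infty}\frac{\left|\{w\in\mathscr{C}_n:\ \mathrm{maj}(w)\equiv r\pmod m\}\right|}{|\mathscr{C}_n|}=\frac1m ,$$ where $|\mathscr{C}_n|=\frac{1}{n+1}\binom{2n}{n}$. That is, the major index over Catalan words of length $2n$ has the balanced property.
   Context: A Catalan word of length $2n$ is a sequence $w=w_1w_2\cdots w_{2n}$ consisting of $n$ zeros and $n$ ones such that no prefix contains more $1$'s than $0$'s. Its major index is $\mathrm{maj}(w)=\sum_{i:\,w_i>w_{i+1}} i$. A statistic $\xi$ on sets $Q_n$ has the balanced property if for every $m\ge 2$ and every $0\le r\le m-1$, $\lim_{n\to\infty}|\{\pi\in Q_n:\xi(\pi)\equiv r \pmod m\}|/|Q_n| = 1/m$. -}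

module Defs where

open import Data.Fin using (Fin; _<?_)
open import Data.Fin.Patterns using (0F; 1F)
open import Data.Fin.Properties using (_≟_)
open import Data.Integer using (+_)
open import Data.List using (List; []; _∷_; length; filter; inits; allFin; cartesianProductWith)
open import Data.List.Membership.Propositional using (_∈_)
open import Data.List.Membership.Propositional.Properties
  using (∈-filter⁺; ∈-filter⁻; ∈-cartesianProductWith⁺; ∈-allFin; ∈-length)
open import Data.List.Properties using (∷-injective)
open import Data.List.Relation.Unary.All as All using (All; []; _∷_; all?)
open import Data.List.Relation.Unary.All.Properties using (map⁺)
open import Data.List.Relation.Unary.Any using (here)
open import Data.List.Relation.Unary.AllPairs using ([]; _∷_)
open import Data.List.Relation.Unary.Unique.Propositional using (Unique)
import Data.List.Relation.Unary.Unique.Propositional.Properties as Unique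
open import Data.Nat as ℕ using (ℕ; zero; suc; _+_; _*_; _∸_; _≤_; _≥_; z≤n; s≤s; NonZero; _%_; >-nonZero)
open import Data.Nat.Properties as ℕ using (+-suc; +-identityʳ)
open import Data.Product using (_×_; _,_; proj₂; ∃-syntax)
open import Data.Rational as ℚ using (ℚ; 0ℚ; _/_; _-_; ∣_∣)
open import Data.Bool using (if_then_else_)
open import Function.Bundles using (_⇔_; mk⇔; module Equivalence)
open import Relation.Binary.PropositionalEquality using (_≡_; refl; sym; trans; cong; cong₂; subst)
open import Relation.Nullary using (does)
open import Relation.Nullary.Decidable using (_×-dec_)
open import Relation.Unary using (Decidable)

-- For a rational sequence with a rational limit it makes no difference
-- whether ε ranges over positive rationals or positive reals.
infix 4 _⟶_
_⟶_ : (ℕ → ℚ) → ℚ → Set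
a ⟶ L = ∀ (ε : ℚ) → 0ℚ ℚ.< ε → ∃[ N ] (∀ n → n ≥ N → ∣ a n - L ∣ ℚ.< ε)

-- Each Q n is a nonempty finite set, given as a list of its elements
-- without repetition, so that cardinalities are lengths.
Balanced : {A : Set} (Q : ℕ → List A) → (∀ n → NonZero (length (Q n))) →
           (A → ℕ) → Set
Balanced Q Q≢∅ ξ =
  ∀ (m : ℕ) .{{_ : NonZero m}} → 2 ≤ m → ∀ (r : ℕ) → r ≤ m ∸ 1 →
  (λ n → (+ length (filter (λ π → ξ π % m ℕ.≟ r % m) (Q n)) / length (Q n)) {{Q≢∅ n}})
    ⟶ + 1 / m

Word : Set
Word = List (Fin 2)

zeros ones : Word → ℕ
zeros w = length (filter (_≟ 0F) w)
ones  w = length (filter (_≟ 1F) w)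

IsCatalan : ℕ → Word → Set
IsCatalan n w = zeros w ≡ n × ones w ≡ n × All (λ p → ones p ≤ zeros p) (inits w)

isCatalan? : ∀ n → Decidable (IsCatalan n)
isCatalan? n w =
  (zeros w ℕ.≟ n) ×-dec (ones w ℕ.≟ n) ×-dec all? (λ p → ones p ℕ.≤? zeros p) (inits w)

words : ℕ → List Word
words zero    = [] ∷ []
words (suc k) = cartesianProductWith _∷_ (allFin 2) (words k)

𝒞 : ℕ → List Word
𝒞 n = filter (isCatalan? n) (words (2 * n))

-- The first argument is the (1-based) position of the first letter.
majFrom : ℕ → Word → ℕ
majFrom i []          = 0
majFrom i (_ ∷ [])    = 0
majFrom i (a ∷ b ∷ w) = (if does (b <? a) then i else 0) + majFrom (suc i) (b ∷ w)

maj : Word → ℕ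
maj = majFrom 1

∈-words : ∀ w → w ∈ words (length w)
∈-words []      = here refl
∈-words (a ∷ w) = ∈-cartesianProductWith⁺ _∷_ (∈-allFin a) (∈-words w)

words-unique : ∀ k → Unique (words k)
words-unique zero    = [] ∷ []
words-unique (suc k) =
  Unique.cartesianProductWith⁺ _∷_ ∷-injective (Unique.allFin⁺ 2) (words-unique k)

𝒞-unique : ∀ n → Unique (𝒞 n)
𝒞-unique n = Unique.filter⁺ (isCatalan? n) (words-unique (2 * n))

length≡zeros+ones : ∀ w → length w ≡ zeros w + ones w
length≡zeros+ones []       = refl
length≡zeros+ones (0F ∷ w) = cong suc (length≡zeros+ones w)
length≡zeros+ones (1F ∷ w) =
  trans (cong suc (length≡zeros+ones w)) (sym (+-suc (zeros w) (ones w)))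

IsCatalan⇒length : ∀ {n w} → IsCatalan n w → length w ≡ 2 * n
IsCatalan⇒length {n} {w} (z , o , _) =
  trans (length≡zeros+ones w) (cong₂ _+_ z (trans o (sym (+-identityʳ n))))

-- IsCatalan n forces length 2n, so with 𝒞-unique this says that length (𝒞 n)
-- is the number of Catalan words of length 2n.
∈-𝒞 : ∀ n w → w ∈ 𝒞 n ⇔ IsCatalan n w
∈-𝒞 n w = mk⇔
  (λ w∈ → proj₂ (∈-filter⁻ (isCatalan? n) {xs = words (2 * n)} w∈))
  (λ c → ∈-filter⁺ (isCatalan? n)
           (subst (λ k → w ∈ words k) (IsCatalan⇒length c) (∈-words w)) c)

zigzag : ℕ → Word
zigzag zero    = []
zigzag (suc n) = 0F ∷ 1F ∷ zigzag n

zigzag-isCatalan : ∀ n → IsCatalan n (zigzag n)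
zigzag-isCatalan zero    = refl , refl , z≤n ∷ []
zigzag-isCatalan (suc n) with zigzag-isCatalan n
... | z , o , _ ∷ ps =
  cong suc z , cong suc o , z≤n ∷ z≤n ∷ s≤s z≤n ∷ map⁺ (map⁺ (All.map s≤s ps))

𝒞-nonEmpty : ∀ n → NonZero (length (𝒞 n))
𝒞-nonEmpty n = >-nonZero (∈-length (Equivalence.from (∈-𝒞 n (zigzag n)) (zigzag-isCatalan n)))

{-# OPTIONS --safe #-}
module Submission where

-- For p < m the words 0^{p+1} 1 0^{m-p} 1 have the same length 3 + m, stay above
-- the starting height, gain the same height, and contribute to maj consecutive
-- values in p.  So among the words with one of these in a given place, all
-- residues of maj mod m are equally frequent.  Cutting words into consecutive
-- pieces of length 3 + m, the frequencies of two residues differ by at most the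
-- number of words without such a piece, which is exponentially small compared
-- to 4^n, whereas the number of Catalan words is at least 4^n/(n+1)².

open import Defs
open import Data.Bool using (true; false; if_then_else_)
open import Data.Fin using (Fin; _<?_)
open import Data.Fin.Patterns using (0F; 1F)
import Data.Integer.Properties as ℤ
open import Data.List using (List; []; _∷_; _++_; length; filter; map; replicate; upTo; inits)
open import Data.List.Membership.Propositional using (_∈_)
open import Data.List.Membership.Propositional.Properties using (∈-∃++; ∈-upTo⁻)
open import Data.List.Properties
  using (map-∘; map-++; map-upTo; upTo-∷ʳ; ++-identityʳ; ++-assoc; length-++;
         length-map; length-upTo; length-replicate; ∷-injectiveʳ)
open import Data.List.Relation.Binary.Permutation.Propositional using (_↭_; ↭-refl; ↭-trans; prep)
open import Data.List.Relation.Binary.Permutation.Propositional.Properties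
  using (∈-resp-↭; shift; ↭-length) renaming (map⁺ to ↭-map⁺)
open import Data.List.Relation.Unary.All as All using (All; []; _∷_)
import Data.List.Relation.Unary.All.Properties as All
open import Data.List.Relation.Unary.AllPairs using ([]; _∷_)
open import Data.List.Relation.Unary.Any using (here; there)
open import Data.List.Relation.Unary.Unique.Propositional using (Unique)
import Data.List.Relation.Unary.Unique.Propositional.Properties as Unique
open import Data.Nat renaming (_*_ to _*ℕ_) hiding (_<?_; _/_)
open import Data.Nat.Combinatorics using (_C_; nCk+nC[k+1]≡[n+1]C[k+1]; nCk≡nC[n∸k])
open import Data.Nat.DivMod
  using (m<n⇒m%n≡m; [m+n]%n≡m%n; m%n<n; m≡m%n+[m/n]*n; /-monoˡ-≤; m*n/n≡m)
  renaming (_/_ to _/ℕ_)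
open import Data.Nat.ListAction using (sum)
open import Data.Nat.ListAction.Properties using (sum-++; sum-↭)
open import Data.Nat.Properties hiding (_<?_)
open import Data.Nat.Tactic.RingSolver using (solve-∀)
open import Data.Product using (_×_; _,_; proj₁; proj₂; ∃-syntax)
open import Data.Rational as ℚ using (ℚ; 0ℚ; mkℚ; _/_; _*_)
import Data.Rational.Properties as ℚ
import Data.Rational.Unnormalised as ℚᵘ
import Data.Rational.Unnormalised.Properties as ℚᵘ
open import Data.Sum using (_⊎_; inj₁; inj₂)
open import Function using (_∘_)
open import Relation.Binary.PropositionalEquality
open import Relation.Nullary using (Dec; does; yes; no; contradiction)
open import Relation.Unary using (Decidable)

-- Residues are not compared directly: `r` stays fixed and the starting value `a` of the major index
-- varies, so that comparing two residues becomes comparing `count a` with `count a′`. After any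
-- first piece, the rest of the word depends only on height, position, last letter and accumulated
-- value. Two runs from `a` and `a′` that read the same piece agree in the first three and keep the
-- difference of the fourth. This is why the comparison has to be proved for all of these parameters
-- at once, and why every block must leave height, position and last letter in the same state.

private
  variable
    A B : Set

-- Finite sums over lists, indicators and residues.

∑ : List A → (A → ℕ) → ℕ
∑ xs f = sum (map f xs)

∑-++ : ∀ (xs ys : List A) f → ∑ (xs ++ ys) f ≡ ∑ xs f + ∑ ys f
∑-++ xs ys f = trans (cong sum (map-++ f xs ys)) (sum-++ (map f xs) (map f ys))

∑-map : ∀ (g : A → B) xs f → ∑ (map g xs) f ≡ ∑ xs (f ∘ g)
∑-map g xs f = cong sum (sym (map-∘ xs))

∑-↭ : ∀ {xs ys : List A} → xs ↭ ys → ∀ f → ∑ xs f ≡ ∑ ys f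
∑-↭ p f = sum-↭ (↭-map⁺ f p)

∑-cong : ∀ (xs : List A) {f g} → (∀ {x} → x ∈ xs → f x ≡ g x) → ∑ xs f ≡ ∑ xs g
∑-cong []       f≗g = refl
∑-cong (x ∷ xs) f≗g = cong₂ _+_ (f≗g (here refl)) (∑-cong xs (f≗g ∘ there))

∑-const : ∀ (xs : List A) c → ∑ xs (λ _ → c) ≡ length xs *ℕ c
∑-const []       c = refl
∑-const (x ∷ xs) c = cong (c +_) (∑-const xs c)

*-distribˡ-∑ : ∀ c (xs : List A) f → c *ℕ ∑ xs f ≡ ∑ xs (λ x → c *ℕ f x)
*-distribˡ-∑ c []       f = *-zeroʳ c
*-distribˡ-∑ c (x ∷ xs) f =
  trans (*-distribˡ-+ c (f x) (∑ xs f)) (cong (c *ℕ f x +_) (*-distribˡ-∑ c xs f))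

+-interchange : ∀ a b c d → a + b + (c + d) ≡ a + c + (b + d)
+-interchange = solve-∀

∑-+ : ∀ (xs : List A) f g → ∑ xs (λ x → f x + g x) ≡ ∑ xs f + ∑ xs g
∑-+ []       f g = refl
∑-+ (x ∷ xs) f g =
  trans (cong (f x + g x +_) (∑-+ xs f g)) (+-interchange (f x) (g x) (∑ xs f) (∑ xs g))

∑-swap : ∀ (xs : List A) (ys : List B) (f : A → B → ℕ) →
         ∑ xs (λ x → ∑ ys (f x)) ≡ ∑ ys (λ y → ∑ xs (λ x → f x y))
∑-swap []       ys f = sym (trans (∑-const ys 0) (*-zeroʳ (length ys)))
∑-swap (x ∷ xs) ys f =
  trans (cong (∑ ys (f x) +_) (∑-swap xs ys f)) (sym (∑-+ ys (f x) (λ y → ∑ xs (λ x → f x y))))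

∑-mono-+ : ∀ (xs : List A) {f g} b → (∀ x → f x ≤ g x + b) → ∑ xs f ≤ ∑ xs g + length xs *ℕ b
∑-mono-+ []       b f≤g+b = z≤n
∑-mono-+ (x ∷ xs) {f} {g} b f≤g+b = begin
  f x + ∑ xs f                         ≤⟨ +-mono-≤ (f≤g+b x) (∑-mono-+ xs b f≤g+b) ⟩
  g x + b + (∑ xs g + length xs *ℕ b)   ≡⟨ +-interchange (g x) b (∑ xs g) (length xs *ℕ b) ⟩
  g x + ∑ xs g + (b + length xs *ℕ b)   ∎
  where open ≤-Reasoning

⟦_⟧ : {P : Set} → Dec P → ℕ
⟦ P? ⟧ = if does P? then 1 else 0

⟦⟧≤1 : {P : Set} (P? : Dec P) → ⟦ P? ⟧ ≤ 1
⟦⟧≤1 (yes _) = ≤-refl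
⟦⟧≤1 (no  _) = z≤n

⟦⟧-unique : {P : Set} (P? : Dec P) {n : ℕ} → n ≤ 1 → (P → n ≡ 1) → (n ≡ 1 → P) → ⟦ P? ⟧ ≡ n
⟦⟧-unique (yes p) _       f g = sym (f p)
⟦⟧-unique (no ¬p) z≤n     f g = refl
⟦⟧-unique (no ¬p) (s≤s z≤n) f g = contradiction (g refl) ¬p

length-filter≡∑ : ∀ {P : A → Set} (P? : Decidable P) xs →
                  length (filter P? xs) ≡ ∑ xs (λ x → ⟦ P? x ⟧)
length-filter≡∑ P? []       = refl
length-filter≡∑ P? (x ∷ xs) with does (P? x)
... | true  = cong suc (length-filter≡∑ P? xs)
... | false = length-filter≡∑ P? xs

∑-filter : ∀ {P : A → Set} (P? : Decidable P) xs f →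
           ∑ (filter P? xs) f ≡ ∑ xs (λ x → ⟦ P? x ⟧ *ℕ f x)
∑-filter P? []       f = refl
∑-filter P? (x ∷ xs) f with does (P? x)
... | true  = cong₂ _+_ (sym (+-identityʳ (f x))) (∑-filter P? xs f)
... | false = ∑-filter P? xs f

∑-upTo-suc : ∀ n (f : ℕ → ℕ) → ∑ (upTo (suc n)) f ≡ f 0 + ∑ (upTo n) (f ∘ suc)
∑-upTo-suc n f = cong (f 0 +_)
  (trans (cong (λ xs → ∑ xs f) (sym (map-upTo suc n))) (∑-map suc (upTo n) f))

∑-upTo-∷ʳ : ∀ n (f : ℕ → ℕ) → ∑ (upTo (suc n)) f ≡ ∑ (upTo n) f + f n
∑-upTo-∷ʳ n f = begin
  ∑ (upTo (suc n)) f          ≡⟨ cong (λ xs → ∑ xs f) (upTo-∷ʳ n) ⟨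
  ∑ (upTo n ++ n ∷ []) f      ≡⟨ ∑-++ (upTo n) (n ∷ []) f ⟩
  ∑ (upTo n) f + (f n + 0)    ≡⟨ cong (∑ (upTo n) f +_) (+-identityʳ (f n)) ⟩
  ∑ (upTo n) f + f n          ∎
  where open ≡-Reasoning

∑-upTo-≟ : ∀ {n r} → r < n → ∑ (upTo n) (λ j → ⟦ j ≟ r ⟧) ≡ 1
∑-upTo-≟ {suc n} {zero}  _         = begin
  ∑ (upTo (suc n)) (λ j → ⟦ j ≟ 0 ⟧)   ≡⟨ ∑-upTo-suc n (λ j → ⟦ j ≟ 0 ⟧) ⟩
  1 + ∑ (upTo n) (λ _ → 0)             ≡⟨ cong suc (∑-const (upTo n) 0) ⟩
  1 + length (upTo n) *ℕ 0              ≡⟨ cong suc (*-zeroʳ (length (upTo n))) ⟩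
  1                                    ∎
  where open ≡-Reasoning
∑-upTo-≟ {suc n} {suc r} (s≤s r<n) =
  trans (∑-upTo-suc n (λ j → ⟦ j ≟ suc r ⟧)) (∑-upTo-≟ r<n)

-- Moving the window of `m` consecutive numbers up by one drops `δ 0` and gains `δ m`, which are
-- equal by periodicity. So the sum does not depend on `x`, and at `x = 0` exactly one number below
-- `m` is `r % m`.
∑-residues : ∀ m .{{_ : NonZero m}} r x → ∑ (upTo m) (λ j → ⟦ (x + j) % m ≟ r % m ⟧) ≡ 1
∑-residues m r zero = trans
  (∑-cong (upTo m) (λ {j} j∈ → cong (λ y → ⟦ y ≟ r % m ⟧) (m<n⇒m%n≡m (∈-upTo⁻ j∈))))
  (∑-upTo-≟ (m%n<n r m))
∑-residues m r (suc x) = +-cancelˡ-≡ (δ 0) _ _ (begin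
  δ 0 + ∑ (upTo m) (λ j → ⟦ suc (x + j) % m ≟ r % m ⟧)
    ≡⟨ cong (δ 0 +_) (∑-cong (upTo m) (λ {j} _ → cong (λ y → ⟦ y % m ≟ r % m ⟧) (sym (+-suc x j)))) ⟩
  δ 0 + ∑ (upTo m) (δ ∘ suc)   ≡⟨ ∑-upTo-suc m δ ⟨
  ∑ (upTo (suc m)) δ           ≡⟨ ∑-upTo-∷ʳ m δ ⟩
  ∑ (upTo m) δ + δ m           ≡⟨ cong₂ _+_ (∑-residues m r x) periodic ⟩
  1 + δ 0                      ≡⟨ +-comm 1 (δ 0) ⟩
  δ 0 + 1                      ∎)
  where
  open ≡-Reasoning
  δ : ℕ → ℕ
  δ j = ⟦ (x + j) % m ≟ r % m ⟧
  periodic : δ m ≡ δ 0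
  periodic = cong (λ y → ⟦ y ≟ r % m ⟧)
    (trans ([m+n]%n≡m%n x m) (cong (_% m) (sym (+-identityʳ x))))

-- Used to split the blocks off the list of all words of their length. Entries of `xs` are removed
-- from `ys` one at a time; distinctness keeps the later ones in what is left.
unique-⊆⇒↭ : ∀ {xs ys : List A} → Unique xs → All (_∈ ys) xs → ∃[ zs ] ys ↭ xs ++ zs
unique-⊆⇒↭ {ys = ys} []          []          = ys , ↭-refl
unique-⊆⇒↭ {xs = x ∷ xs} (x∉ ∷ u) (x∈ ∷ xs⊆) with as , bs , refl ← ∈-∃++ x∈ =
  let zs , p = unique-⊆⇒↭ u (All.zipWith drop-x (x∉ , xs⊆))
  in  zs , ↭-trans (shift x as bs) (prep x p)
  where
  drop-x : ∀ {y} → x ≢ y × y ∈ as ++ x ∷ bs → y ∈ as ++ bs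
  drop-x (x≢y , y∈) with ∈-resp-↭ (shift x as bs) y∈
  ... | here y≡x = contradiction (sym y≡x) x≢y
  ... | there y∈′ = y∈′

-- Sums over all words of a given length.

∑-words-suc : ∀ k f → ∑ (words (suc k)) f ≡ ∑ (words k) (f ∘ (0F ∷_)) + ∑ (words k) (f ∘ (1F ∷_))
∑-words-suc k f = begin
  ∑ (map (0F ∷_) (words k) ++ map (1F ∷_) (words k) ++ []) f
    ≡⟨ cong (λ ws → ∑ (map (0F ∷_) (words k) ++ ws) f) (++-identityʳ _) ⟩
  ∑ (map (0F ∷_) (words k) ++ map (1F ∷_) (words k)) f
    ≡⟨ ∑-++ (map (0F ∷_) (words k)) _ f ⟩
  ∑ (map (0F ∷_) (words k)) f + ∑ (map (1F ∷_) (words k)) f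
    ≡⟨ cong₂ _+_ (∑-map (0F ∷_) (words k) f) (∑-map (1F ∷_) (words k) f) ⟩
  ∑ (words k) (f ∘ (0F ∷_)) + ∑ (words k) (f ∘ (1F ∷_))  ∎
  where open ≡-Reasoning

∑-words-+ : ∀ j k f → ∑ (words (j + k)) f ≡ ∑ (words j) (λ u → ∑ (words k) (λ v → f (u ++ v)))
∑-words-+ zero    k f = sym (+-identityʳ _)
∑-words-+ (suc j) k f = begin
  ∑ (words (suc (j + k))) f
    ≡⟨ ∑-words-suc (j + k) f ⟩
  ∑ (words (j + k)) (f ∘ (0F ∷_)) + ∑ (words (j + k)) (f ∘ (1F ∷_))
    ≡⟨ cong₂ _+_ (∑-words-+ j k (f ∘ (0F ∷_))) (∑-words-+ j k (f ∘ (1F ∷_))) ⟩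
  _ ≡⟨ ∑-words-suc j (λ u → ∑ (words k) (λ v → f (u ++ v))) ⟨
  ∑ (words (suc j)) (λ u → ∑ (words k) (λ v → f (u ++ v)))  ∎
  where open ≡-Reasoning

length-words : ∀ k → length (words k) ≡ 2 ^ k
length-words zero    = refl
length-words (suc k) = begin
  length (words (suc k))                ≡⟨ length≡∑ (words (suc k)) ⟩
  ∑ (words (suc k)) (λ _ → 1)           ≡⟨ ∑-words-suc k (λ _ → 1) ⟩
  ∑ (words k) (λ _ → 1) + ∑ (words k) (λ _ → 1)
    ≡⟨ cong (λ n → n + n) (trans (sym (length≡∑ (words k))) (length-words k)) ⟩
  2 ^ k + 2 ^ k                         ≡⟨ cong (2 ^ k +_) (+-identityʳ (2 ^ k)) ⟨
  2 ^ suc k                             ∎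
  where
  open ≡-Reasoning
  length≡∑ : ∀ (ws : List Word) → length ws ≡ ∑ ws (λ _ → 1)
  length≡∑ ws = sym (trans (∑-const ws 1) (*-identityʳ (length ws)))

∈-words⇒length : ∀ k {w} → w ∈ words k → length w ≡ k
∈-words⇒length k = All.lookup (all-length k)
  where
  all-length : ∀ k → All (λ w → length w ≡ k) (words k)
  all-length zero    = refl ∷ []
  all-length (suc k) = All.++⁺ (All.map⁺ cons) (All.++⁺ (All.map⁺ cons) [])
    where
    cons : All (λ w → suc (length w) ≡ suc k) (words k)
    cons = All.map (cong suc) (all-length k)

-- Catalan words as lattice paths.

-- Indicator of lattice paths from height h to 0 that stay nonnegative, with a
-- zero as up-step and a one as down-step.
path : ℕ → Word → ℕ
path zero    []       = 1
path (suc h) []       = 0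
path h       (0F ∷ w) = path (suc h) w
path zero    (1F ∷ w) = 0
path (suc h) (1F ∷ w) = path h w

path≤1 : ∀ h w → path h w ≤ 1
path≤1 zero    []       = ≤-refl
path≤1 (suc h) []       = z≤n
path≤1 zero    (0F ∷ w) = path≤1 1 w
path≤1 (suc h) (0F ∷ w) = path≤1 (2 + h) w
path≤1 zero    (1F ∷ w) = z≤n
path≤1 (suc h) (1F ∷ w) = path≤1 h w

path-0F : ∀ h w → path h (0F ∷ w) ≡ path (suc h) w
path-0F zero    w = refl
path-0F (suc h) w = refl

-- A prefix acts on the rest of the path only through the height it reaches, unless it has already
-- gone below 0. This is what lets a count be continued after a fixed prefix.
path-++ : ∀ h u → (∀ v → path h (u ++ v) ≡ 0) ⊎ ∃[ h′ ] (∀ v → path h (u ++ v) ≡ path h′ v)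
path-++ h       []       = inj₂ (h , λ _ → refl)
path-++ zero    (0F ∷ u) = path-++ 1 u
path-++ (suc h) (0F ∷ u) = path-++ (2 + h) u
path-++ zero    (1F ∷ u) = inj₁ (λ _ → refl)
path-++ (suc h) (1F ∷ u) = path-++ h u

path-replicate : ∀ h p v → path h (replicate p 0F ++ v) ≡ path (p + h) v
path-replicate h zero    v = refl
path-replicate h (suc p) v = begin
  path h (0F ∷ replicate p 0F ++ v)   ≡⟨ path-0F h _ ⟩
  path (suc h) (replicate p 0F ++ v)  ≡⟨ path-replicate (suc h) p v ⟩
  path (p + suc h) v                  ≡⟨ cong (λ n → path n v) (+-suc p h) ⟩
  path (suc p + h) v                  ∎
  where open ≡-Reasoning

IsPath : ℕ → Word → Set
IsPath h w = h + zeros w ≡ ones w × All (λ p → ones p ≤ h + zeros p) (inits w)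

path≡1⇒IsPath : ∀ h w → path h w ≡ 1 → IsPath h w
path≡1⇒IsPath zero    []       _ = refl , z≤n ∷ []
path≡1⇒IsPath (suc h) []       ()
path≡1⇒IsPath h       (0F ∷ w) e
  with eq , ≥0 ← path≡1⇒IsPath (suc h) w (trans (sym (path-0F h w)) e)
  = trans (+-suc h (zeros w)) eq ,
    z≤n ∷ All.map⁺ (All.map (λ {p} le → ≤-trans le (≤-reflexive (sym (+-suc h (zeros p))))) ≥0)
path≡1⇒IsPath zero    (1F ∷ w) ()
path≡1⇒IsPath (suc h) (1F ∷ w) e with eq , ≥0 ← path≡1⇒IsPath h w e =
  cong suc eq , z≤n ∷ All.map⁺ (All.map s≤s ≥0)

IsPath⇒path≡1 : ∀ h w → IsPath h w → path h w ≡ 1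
IsPath⇒path≡1 zero    []       _  = refl
IsPath⇒path≡1 (suc h) []       (() , _)
IsPath⇒path≡1 h       (0F ∷ w) (eq , _ ∷ ≥0) = trans (path-0F h w) (IsPath⇒path≡1 (suc h) w
  (trans (sym (+-suc h (zeros w))) eq ,
   All.map (λ {p} le → ≤-trans le (≤-reflexive (+-suc h (zeros p)))) (All.map⁻ ≥0)))
IsPath⇒path≡1 zero    (1F ∷ w) (_ , _ ∷ () ∷ _)
IsPath⇒path≡1 (suc h) (1F ∷ w) (eq , _ ∷ ≥0) =
  IsPath⇒path≡1 h w (suc-injective eq , All.map s≤s⁻¹ (All.map⁻ ≥0))

-- `path` only records that zeros and ones are equally many; the length `2n` then forces both
-- numbers to be `n`.
⟦isCatalan?⟧≡path : ∀ n {w} → w ∈ words (2 *ℕ n) → ⟦ isCatalan? n w ⟧ ≡ path 0 w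
⟦isCatalan?⟧≡path n {w} w∈ = ⟦⟧-unique (isCatalan? n w) (path≤1 0 w)
  (λ (z , o , ≥0) → IsPath⇒path≡1 0 w (trans z (sym o) , ≥0))
  (λ e → let z≡o , ≥0 = path≡1⇒IsPath 0 w e
         in  zeros≡n z≡o , trans (sym z≡o) (zeros≡n z≡o) , ≥0)
  where
  zeros≡n : zeros w ≡ ones w → zeros w ≡ n
  zeros≡n z≡o = *-cancelˡ-≡ (zeros w) n 2 (begin
    zeros w + (zeros w + 0)  ≡⟨ cong (zeros w +_) (trans (+-identityʳ _) z≡o) ⟩
    zeros w + ones w         ≡⟨ length≡zeros+ones w ⟨
    length w                 ≡⟨ ∈-words⇒length (2 *ℕ n) w∈ ⟩
    2 *ℕ n                    ∎)
    where open ≡-Reasoning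

-- The number of Catalan words and a lower bound for it.

paths : ℕ → ℕ → ℕ
paths k h = ∑ (words k) (path h)

length-𝒞 : ∀ n → length (𝒞 n) ≡ paths (2 *ℕ n) 0
length-𝒞 n = trans (length-filter≡∑ (isCatalan? n) (words (2 *ℕ n)))
                   (∑-cong (words (2 *ℕ n)) (⟦isCatalan?⟧≡path n))

paths-zero : ∀ k → paths (suc k) 0 ≡ paths k 1
paths-zero k = begin
  paths (suc k) 0                        ≡⟨ ∑-words-suc k (path 0) ⟩
  paths k 1 + ∑ (words k) (λ _ → 0)      ≡⟨ cong (paths k 1 +_) (∑-const (words k) 0) ⟩
  paths k 1 + length (words k) *ℕ 0       ≡⟨ cong (paths k 1 +_) (*-zeroʳ (length (words k))) ⟩
  paths k 1 + 0                          ≡⟨ +-identityʳ _ ⟩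
  paths k 1                              ∎
  where open ≡-Reasoning

paths-suc : ∀ k h → paths (suc k) (suc h) ≡ paths k (2 + h) + paths k h
paths-suc k h = ∑-words-suc k (path (suc h))

k<h⇒paths≡0 : ∀ {k h} → k < h → paths k h ≡ 0
k<h⇒paths≡0 {zero}  {suc h} _         = refl
k<h⇒paths≡0 {suc k} {suc h} (s≤s k<h) =
  trans (paths-suc k h) (cong₂ _+_ (k<h⇒paths≡0 (m<n⇒m<1+n (m<n⇒m<1+n k<h))) (k<h⇒paths≡0 k<h))

paths-h-h : ∀ h → paths h h ≡ 1
paths-h-h zero    = refl
paths-h-h (suc h) =
  trans (paths-suc h h) (cong₂ _+_ (k<h⇒paths≡0 (m<n⇒m<1+n (n<1+n h))) (paths-h-h h))

C-symmetric : ∀ z → suc (z + z) C suc z ≡ suc (z + z) C z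
C-symmetric z = trans (nCk≡nC[n∸k] (s≤s (m≤m+n z z)))
                      (cong (suc (z + z) C_) (m+n∸m≡n z z))

-- The binomial coefficient `k C (z - 1)` with value 0 at `z = 0`, where truncated subtraction would
-- give `k C 0 = 1`. With this convention Pascal's rule holds for every `z`.
_C⁻_ : ℕ → ℕ → ℕ
k C⁻ zero  = 0
k C⁻ suc z = k C z

C⁻-pascal : ∀ k z → k C⁻ z + k C z ≡ suc k C z
C⁻-pascal k zero    = refl
C⁻-pascal k (suc z) = nCk+nC[k+1]≡[n+1]C[k+1] k z

-- The reflection principle: k C (z - 1) counts the words with z zeros that
-- go below 0.
reflection : ∀ k z h → k ≡ z + z + h → paths k h + k C⁻ z ≡ k C z
reflection k       zero    h       refl = cong (_+ 0) (paths-h-h h)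
reflection (suc k) (suc z) zero    e    = begin
  paths (suc k) 0 + suc k C z          ≡⟨ cong₂ _+_ (paths-zero k) (sym (C⁻-pascal k z)) ⟩
  paths k 1 + (k C⁻ z + k C z)         ≡⟨ +-assoc (paths k 1) _ _ ⟨
  paths k 1 + k C⁻ z + k C z           ≡⟨ cong (_+ k C z) (reflection k z 1 (trans k≡ (+-comm 1 (z + z)))) ⟩
  -- At height 0 a first down-step is fatal, so only one of the two recursive terms is present. The
  -- symmetry of the two middle coefficients for `k = 2z + 1` supplies the other.
  k C z + k C z                        ≡⟨ cong (λ n → k C z + n) sym-k ⟩
  k C z + k C suc z                    ≡⟨ nCk+nC[k+1]≡[n+1]C[k+1] k z ⟩
  suc k C suc z                        ∎
  where
  open ≡-Reasoning
  k≡ : k ≡ suc (z + z)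
  k≡ = trans (suc-injective e) (trans (+-identityʳ _) (+-suc z z))
  sym-k : k C z ≡ k C suc z
  sym-k = subst (λ n → n C z ≡ n C suc z) (sym k≡) (sym (C-symmetric z))
reflection (suc k) (suc z) (suc h) e    = begin
  paths (suc k) (suc h) + suc k C z
    ≡⟨ cong₂ _+_ (paths-suc k h) (sym (C⁻-pascal k z)) ⟩
  paths k (2 + h) + paths k h + (k C⁻ z + k C z)
    ≡⟨ +-interchange (paths k (2 + h)) (paths k h) (k C⁻ z) (k C z) ⟩
  (paths k (2 + h) + k C⁻ z) + (paths k h + k C z)
    ≡⟨ cong₂ _+_ (reflection k z (2 + h) (trans (suc-injective e) (shift₁ z h)))
                 (reflection k (suc z) h (trans (suc-injective e) (shift₂ z h))) ⟩
  k C z + k C suc z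
    ≡⟨ nCk+nC[k+1]≡[n+1]C[k+1] k z ⟩
  suc k C suc z  ∎
  where
  open ≡-Reasoning
  shift₁ : ∀ z h → z + suc z + suc h ≡ z + z + (2 + h)
  shift₁ = solve-∀
  shift₂ : ∀ z h → z + suc z + suc h ≡ suc z + suc z + h
  shift₂ = solve-∀

-- The absorption identity. Pascal's rule splits the left side, the induction hypothesis applies at
-- `k` and, through `lower`, at `k - 1`, and Pascal's rule joins the results.
[1+k]*[1+n]C[1+k]≡[1+n]*nCk : ∀ n k → suc k *ℕ (suc n C suc k) ≡ suc n *ℕ (n C k)
[1+k]*[1+n]C[1+k]≡[1+n]*nCk zero    zero    = refl
[1+k]*[1+n]C[1+k]≡[1+n]*nCk zero    (suc k) = *-zeroʳ (2 + k)
[1+k]*[1+n]C[1+k]≡[1+n]*nCk (suc n) k = begin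
  suc k *ℕ (suc (suc n) C suc k)               ≡⟨ cong (suc k *ℕ_) (nCk+nC[k+1]≡[n+1]C[k+1] (suc n) k) ⟨
  suc k *ℕ (a + suc n C suc k)                 ≡⟨ *-distribˡ-+ (suc k) a _ ⟩
  a + k *ℕ a + suc k *ℕ (suc n C suc k)         ≡⟨ cong₂ (λ x y → a + x + y) (lower k) ([1+k]*[1+n]C[1+k]≡[1+n]*nCk n k) ⟩
  a + suc n *ℕ (n C⁻ k) + suc n *ℕ (n C k)      ≡⟨ +-assoc a _ _ ⟩
  a + (suc n *ℕ (n C⁻ k) + suc n *ℕ (n C k))    ≡⟨ cong (a +_) (*-distribˡ-+ (suc n) (n C⁻ k) (n C k)) ⟨
  a + suc n *ℕ (n C⁻ k + n C k)                ≡⟨ cong (λ x → a + suc n *ℕ x) (C⁻-pascal n k) ⟩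
  a + suc n *ℕ a                               ∎
  where
  open ≡-Reasoning
  a = suc n C k
  lower : ∀ k → k *ℕ (suc n C k) ≡ suc n *ℕ (n C⁻ k)
  lower zero    = sym (*-zeroʳ (suc n))
  lower (suc k) = [1+k]*[1+n]C[1+k]≡[1+n]*nCk n k

-- The reflection identity at height 0, multiplied by `n + 1`. Since
-- `(n + 1) * C(2n, n-1) = n * C(2n, n)`, adding `n * c` to both sides replaces the subtraction.
catalan-number : ∀ n → suc n *ℕ length (𝒞 n) ≡ (2 *ℕ n) C n
catalan-number n = +-cancelʳ-≡ (n *ℕ c) _ _ (begin
  suc n *ℕ length (𝒞 n) + n *ℕ c
    ≡⟨ cong₂ _+_ (cong (suc n *ℕ_) (length-𝒞 n)) (sym (absorb n)) ⟩
  suc n *ℕ paths (2 *ℕ n) 0 + suc n *ℕ ((2 *ℕ n) C⁻ n)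
    ≡⟨ *-distribˡ-+ (suc n) (paths (2 *ℕ n) 0) _ ⟨
  suc n *ℕ (paths (2 *ℕ n) 0 + (2 *ℕ n) C⁻ n)
    ≡⟨ cong (suc n *ℕ_) (reflection (2 *ℕ n) n 0 (sym (+-assoc n n 0))) ⟩
  c + n *ℕ c  ∎)
  where
  open ≡-Reasoning
  c = (2 *ℕ n) C n
  absorb : ∀ n → suc n *ℕ ((2 *ℕ n) C⁻ n) ≡ n *ℕ ((2 *ℕ n) C n)
  absorb zero      = refl
  absorb n@(suc k) = +-cancelʳ-≡ (n *ℕ (N C k)) _ _ (begin
    suc n *ℕ (N C k) + n *ℕ (N C k)            ≡⟨ merge n (N C k) ⟩
    suc N *ℕ (N C k)                          ≡⟨ [1+k]*[1+n]C[1+k]≡[1+n]*nCk N k ⟨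
    n *ℕ (suc N C n)                          ≡⟨ cong (n *ℕ_) (nCk+nC[k+1]≡[n+1]C[k+1] N k) ⟨
    n *ℕ (N C k + N C n)                      ≡⟨ *-distribˡ-+ n (N C k) (N C n) ⟩
    n *ℕ (N C k) + n *ℕ (N C n)                ≡⟨ +-comm (n *ℕ (N C k)) _ ⟩
    n *ℕ (N C n) + n *ℕ (N C k)                ∎)
    where
    N = 2 *ℕ n
    merge : ∀ n x → suc n *ℕ x + n *ℕ x ≡ suc (2 *ℕ n) *ℕ x
    merge = solve-∀

4^n≤[1+n]*2nCn : ∀ n → 2 ^ (2 *ℕ n) ≤ suc n *ℕ ((2 *ℕ n) C n)
4^n≤[1+n]*2nCn zero    = ≤-refl
4^n≤[1+n]*2nCn (suc n) = *-cancelˡ-≤ (suc n) (begin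
  suc n *ℕ 2 ^ (2 *ℕ suc n)            ≡⟨ cong (λ k → suc n *ℕ 2 ^ k) (*-suc 2 n) ⟩
  suc n *ℕ (2 *ℕ (2 *ℕ 2 ^ (2 *ℕ n)))    ≤⟨ *-monoʳ-≤ (suc n) (*-monoʳ-≤ 2 (*-monoʳ-≤ 2 (4^n≤[1+n]*2nCn n))) ⟩
  -- The growth factor 4 is absorbed because `4(n+1)² + 2n = 2(n+2)(2n+1)`; the discarded slack is
  -- `2n * c`.
  suc n *ℕ (2 *ℕ (2 *ℕ (suc n *ℕ c)))    ≤⟨ m+n≤o⇒m≤o _ (≤-reflexive (expand n c)) ⟩
  (2 + n) *ℕ (2 *ℕ (suc (2 *ℕ n) *ℕ c))  ≡⟨ cong (λ x → (2 + n) *ℕ (2 *ℕ x)) ([1+k]*[1+n]C[1+k]≡[1+n]*nCk (2 *ℕ n) n) ⟨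
  (2 + n) *ℕ (2 *ℕ (suc n *ℕ c₁))       ≡⟨ regroup n c₁ ⟩
  suc n *ℕ ((2 + n) *ℕ (c₁ + c₁))      ≡⟨ cong (λ x → suc n *ℕ ((2 + n) *ℕ x)) double ⟩
  suc n *ℕ ((2 + n) *ℕ ((2 *ℕ suc n) C suc n))  ∎)
  where
  open ≤-Reasoning
  c = (2 *ℕ n) C n
  c₁ = suc (2 *ℕ n) C suc n
  expand : ∀ n c → suc n *ℕ (2 *ℕ (2 *ℕ (suc n *ℕ c))) + 2 *ℕ n *ℕ c ≡ (2 + n) *ℕ (2 *ℕ (suc (2 *ℕ n) *ℕ c))
  expand = solve-∀
  regroup : ∀ n x → (2 + n) *ℕ (2 *ℕ (suc n *ℕ x)) ≡ suc n *ℕ ((2 + n) *ℕ (x + x))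
  regroup = solve-∀
  n+n≡2n : n + n ≡ 2 *ℕ n
  n+n≡2n = cong (n +_) (sym (+-identityʳ n))
  double : c₁ + c₁ ≡ (2 *ℕ suc n) C suc n
  double = trans (cong (_+ c₁) (subst (λ k → suc k C suc n ≡ suc k C n) n+n≡2n (C-symmetric n)))
          (trans (nCk+nC[k+1]≡[n+1]C[k+1] (suc (2 *ℕ n)) n) (cong (_C suc n) (sym (*-suc 2 n))))

4^n≤[1+n]²*length-𝒞 : ∀ n → 2 ^ (2 *ℕ n) ≤ suc n *ℕ suc n *ℕ length (𝒞 n)
4^n≤[1+n]²*length-𝒞 n = begin
  2 ^ (2 *ℕ n)                      ≤⟨ 4^n≤[1+n]*2nCn n ⟩
  suc n *ℕ ((2 *ℕ n) C n)            ≡⟨ cong (suc n *ℕ_) (catalan-number n) ⟨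
  suc n *ℕ (suc n *ℕ length (𝒞 n))   ≡⟨ *-assoc (suc n) (suc n) _ ⟨
  suc n *ℕ suc n *ℕ length (𝒞 n)     ∎
  where open ≤-Reasoning

-- The major index of a concatenation.

descent : ℕ → Fin 2 → Fin 2 → ℕ
descent i a b = if does (b <? a) then i else 0

lastLetter : Fin 2 → Word → Fin 2
lastLetter c []      = c
lastLetter c (a ∷ w) = lastLetter a w

lastLetter-++-∷ : ∀ c u a v → lastLetter c (u ++ a ∷ v) ≡ lastLetter a v
lastLetter-++-∷ c []      a v = refl
lastLetter-++-∷ c (b ∷ u) a v = lastLetter-++-∷ b u a v

-- The last letter before `v` is kept in front of it, so a descent at the junction is counted
-- exactly once, in the second summand.
majFrom-++ : ∀ i c u v →
  majFrom i (c ∷ u ++ v) ≡ majFrom i (c ∷ u) + majFrom (i + length u) (lastLetter c u ∷ v)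
majFrom-++ i c []      v = cong (λ j → majFrom j (c ∷ v)) (sym (+-identityʳ i))
majFrom-++ i c (a ∷ u) v = begin
  d + majFrom (suc i) (a ∷ u ++ v)
    ≡⟨ cong (d +_) (majFrom-++ (suc i) a u v) ⟩
  d + (majFrom (suc i) (a ∷ u) + majFrom (suc i + length u) w)
    ≡⟨ +-assoc d (majFrom (suc i) (a ∷ u)) _ ⟨
  d + majFrom (suc i) (a ∷ u) + majFrom (suc i + length u) w
    ≡⟨ cong (λ j → d + majFrom (suc i) (a ∷ u) + majFrom j w) (sym (+-suc i (length u))) ⟩
  d + majFrom (suc i) (a ∷ u) + majFrom (i + suc (length u)) w  ∎
  where
  open ≡-Reasoning
  d = descent i c a
  w = lastLetter a u ∷ v

majFrom-replicate : ∀ i p w → majFrom i (0F ∷ replicate p 0F ++ w) ≡ majFrom (p + i) (0F ∷ w)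
majFrom-replicate i zero    w = refl
majFrom-replicate i (suc p) w =
  trans (majFrom-replicate (suc i) p w) (cong (λ j → majFrom j (0F ∷ w)) (+-suc p i))

-- Prepending a zero in position 0 creates no descent.
maj≡majFrom-0F : ∀ w → maj w ≡ majFrom 0 (0F ∷ w)
maj≡majFrom-0F []       = refl
maj≡majFrom-0F (0F ∷ w) = refl
maj≡majFrom-0F (1F ∷ w) = refl

-- Blocks and their effect on height and major index.

module _ (m : ℕ) .{{_ : NonZero m}} where

  -- The exponents `p + 1` and `m - p` are both positive for `p < m`. Hence every block begins with
  -- 0 and ends with 1, so the descents at its two ends do not depend on `p`; it never dips below
  -- its starting height; and it has exactly one inner descent, at its letter `p + 2`.
  block : ℕ → Word
  block p = replicate (suc p) 0F ++ 1F ∷ replicate (m ∸ p) 0F ++ 1F ∷ []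

  length-block : ∀ {p} → p < m → length (block p) ≡ 3 + m
  length-block {p} p<m = begin
    length (block p)
      ≡⟨ length-++ (replicate (suc p) 0F) ⟩
    length (replicate (suc p) 0F) + suc (length (replicate (m ∸ p) 0F ++ 1F ∷ []))
      ≡⟨ cong₂ (λ x y → x + suc y) (length-replicate (suc p)) (length-++ (replicate (m ∸ p) 0F)) ⟩
    suc p + suc (length (replicate (m ∸ p) 0F) + 1)
      ≡⟨ cong (λ x → suc p + suc (x + 1)) (length-replicate (m ∸ p)) ⟩
    suc p + suc (m ∸ p + 1)
      ≡⟨ regroup p (m ∸ p) ⟩
    3 + (p + (m ∸ p))
      ≡⟨ cong (3 +_) (m+[n∸m]≡n (<⇒≤ p<m)) ⟩
    3 + m  ∎
    where
    open ≡-Reasoning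
    regroup : ∀ p q → suc p + suc (q + 1) ≡ 3 + (p + q)
    regroup = solve-∀

  block-injective : ∀ {p q} → block p ≡ block q → p ≡ q
  block-injective {p} {q} e = leading p q (∷-injectiveʳ e)
    where
    leading : ∀ p q {v w} → replicate p 0F ++ 1F ∷ v ≡ replicate q 0F ++ 1F ∷ w → p ≡ q
    leading zero    zero    _  = refl
    leading (suc p) (suc q) e  = cong suc (leading p q (∷-injectiveʳ e))
    leading zero    (suc q) ()
    leading (suc p) zero    ()

  path-block : ∀ h {p} v → p < m → path h (block p ++ v) ≡ path (pred m + h) v
  path-block h {p} v p<m = begin
    path h (block p ++ v)
      ≡⟨ cong (path h) (++-assoc (replicate (suc p) 0F) _ v) ⟩
    path h (replicate (suc p) 0F ++ 1F ∷ (replicate (m ∸ p) 0F ++ 1F ∷ []) ++ v)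
      ≡⟨ path-replicate h (suc p) _ ⟩
    path (p + h) ((replicate (m ∸ p) 0F ++ 1F ∷ []) ++ v)
      ≡⟨ cong (path (p + h)) (++-assoc (replicate (m ∸ p) 0F) _ v) ⟩
    path (p + h) (replicate (m ∸ p) 0F ++ 1F ∷ v)
      ≡⟨ path-replicate (p + h) (m ∸ p) _ ⟩
    path (m ∸ p + (p + h)) (1F ∷ v)
      ≡⟨ cong (λ x → path x (1F ∷ v)) height ⟩
    path (pred m + h) v  ∎
    where
    open ≡-Reasoning
    height : m ∸ p + (p + h) ≡ suc (pred m + h)
    height = trans (sym (+-assoc (m ∸ p) p h))
            (trans (cong (_+ h) (m∸n+n≡m (<⇒≤ p<m))) (cong (_+ h) (sym (suc-pred m))))

  majFrom-block : ∀ i c {p} → p < m →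
    majFrom i (c ∷ block p) ≡ descent i c 0F + (2 + i) + p
  majFrom-block i c {p} p<m = begin
    d + majFrom (suc i) (block p)
      ≡⟨ cong (d +_) (majFrom-replicate (suc i) p _) ⟩
    d + majFrom (suc (p + suc i)) (1F ∷ replicate (m ∸ p) 0F ++ 1F ∷ [])
      -- Exposing a zero after the first 1 makes the inner descent visible to the evaluation of
      -- `majFrom`; this is where `p < m` matters.
      ≡⟨ cong (λ q → d + majFrom (suc (p + suc i)) (1F ∷ replicate q 0F ++ 1F ∷ [])) m∸p≡ ⟩
    d + (suc (p + suc i) + majFrom (2 + (p + suc i)) (0F ∷ replicate (pred (m ∸ p)) 0F ++ 1F ∷ []))
      ≡⟨ cong (λ x → d + (suc (p + suc i) + x)) (majFrom-replicate (2 + (p + suc i)) (pred (m ∸ p)) _) ⟩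
    d + (suc (p + suc i) + 0)
      ≡⟨ regroup d i p ⟩
    d + (2 + i) + p  ∎
    where
    open ≡-Reasoning
    d = descent i c 0F
    m∸p≡ : m ∸ p ≡ suc (pred (m ∸ p))
    m∸p≡ = sym (suc-pred (m ∸ p) {{>-nonZero (m<n⇒0<n∸m p<m)}})
    regroup : ∀ d i p → d + (suc (p + suc i) + 0) ≡ d + (2 + i) + p
    regroup = solve-∀

  lastLetter-block : ∀ c p → lastLetter c (block p) ≡ 1F
  lastLetter-block c p = trans (lastLetter-++-∷ c (replicate (suc p) 0F) _ _)
                               (lastLetter-++-∷ 1F (replicate (m ∸ p) 0F) _ _)

  blocks : List Word
  blocks = map block (upTo m)

  nonBlocks : ∃[ zs ] words (3 + m) ↭ blocks ++ zs
  nonBlocks = unique-⊆⇒↭ (Unique.map⁺ block-injective (Unique.upTo⁺ m))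
    (All.map⁺ (All.tabulate λ {p} p∈ →
      subst (λ k → block p ∈ words k) (length-block (∈-upTo⁻ p∈)) (∈-words (block p))))

  -- All `m` blocks are removed, but the loss of a single word suffices. The bound is weakened to
  -- base `d` with `d + 1 = 2 ^ (3 + m)`, the shape that Bernoulli's inequality takes.
  length-nonBlocks : length (proj₁ nonBlocks) ≤ 2 ^ (3 + m) ∸ 1
  length-nonBlocks with zs , p ← nonBlocks = begin
    length zs                       ≤⟨ m≤n+m (length zs) (pred m) ⟩
    pred m + length zs              ≡⟨ cong (_∸ 1) total ⟩
    2 ^ (3 + m) ∸ 1                 ∎
    where
    open ≤-Reasoning
    total : suc (pred m) + length zs ≡ 2 ^ (3 + m)
    total = begin-equality
      suc (pred m) + length zs      ≡⟨ cong (_+ length zs) (suc-pred m) ⟩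
      m + length zs                 ≡⟨ cong (_+ length zs) (trans (length-map block (upTo m)) (length-upTo m)) ⟨
      length blocks + length zs     ≡⟨ length-++ blocks ⟨
      length (blocks ++ zs)         ≡⟨ ↭-length p ⟨
      length (words (3 + m))        ≡⟨ length-words (3 + m) ⟩
      2 ^ (3 + m)                   ∎

  -- Near-equality of the residue counts.

  module _ (r : ℕ) where

    δ : ℕ → ℕ
    δ x = ⟦ x % m ≟ r % m ⟧

    -- c is the letter in position i, directly before w; a is the major index
    -- accumulated before that.
    count : ℕ → ℕ → Fin 2 → ℕ → ℕ → ℕ
    count a i c h k = ∑ (words k) (λ w → path h w *ℕ δ (a + majFrom i (c ∷ w)))

    count≤2^k : ∀ a i c h k → count a i c h k ≤ 2 ^ k
    count≤2^k a i c h k = begin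
      count a i c h k                          ≤⟨ ∑-mono-+ (words k) {g = λ _ → 0} 1 (λ w → *-mono-≤ (path≤1 h w) (⟦⟧≤1 ((a + majFrom i (c ∷ w)) % m ≟ r % m))) ⟩
      ∑ (words k) (λ _ → 0) + length (words k) *ℕ 1
        ≡⟨ cong₂ _+_ (trans (∑-const (words k) 0) (*-zeroʳ (length (words k)))) (trans (*-identityʳ (length (words k))) (length-words k)) ⟩
      2 ^ k                                    ∎
      where open ≤-Reasoning

    -- For a fixed word the `m` consecutive starting values give every residue once, so exactly one
    -- of them leads to `r`. Each path is therefore counted once.
    ∑-count : ∀ a i c h k → ∑ (upTo m) (λ j → count (a + j) i c h k) ≡ paths k h
    ∑-count a i c h k = begin
      ∑ (upTo m) (λ j → count (a + j) i c h k)
        ≡⟨ ∑-swap (upTo m) (words k) _ ⟩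
      ∑ (words k) (λ w → ∑ (upTo m) (λ j → path h w *ℕ δ (a + j + M w)))
        ≡⟨ ∑-cong (words k) (λ {w} _ → sym (*-distribˡ-∑ (path h w) (upTo m) _)) ⟩
      ∑ (words k) (λ w → path h w *ℕ ∑ (upTo m) (λ j → δ (a + j + M w)))
        ≡⟨ ∑-cong (words k) (λ {w} _ → cong (path h w *ℕ_)
             (trans (∑-cong (upTo m) (λ {j} _ → cong δ (regroup a j (M w)))) (∑-residues m r (a + M w)))) ⟩
      ∑ (words k) (λ w → path h w *ℕ 1)
        ≡⟨ ∑-cong (words k) (λ {w} _ → *-identityʳ (path h w)) ⟩
      paths k h  ∎
      where
      open ≡-Reasoning
      M : Word → ℕ
      M w = majFrom i (c ∷ w)
      regroup : ∀ a j x → a + j + x ≡ a + x + j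
      regroup = solve-∀

    countAfter : ℕ → ℕ → Fin 2 → ℕ → ℕ → Word → ℕ
    countAfter a i c h k u = ∑ (words k) (λ v → path h (u ++ v) *ℕ δ (a + majFrom i (c ∷ u ++ v)))

    -- Closes the recursion: behind a surviving prefix the count is again a `count`, with all its
    -- parameters updated.
    countAfter≡count : ∀ a i c h {h′} k u → (∀ v → path h (u ++ v) ≡ path h′ v) →
      countAfter a i c h k u ≡ count (a + majFrom i (c ∷ u)) (i + length u) (lastLetter c u) h′ k
    countAfter≡count a i c h k u path≗ = ∑-cong (words k) λ {v} _ →
      cong₂ (λ x y → x *ℕ δ y) (path≗ v)
        (trans (cong (a +_) (majFrom-++ i c u v)) (sym (+-assoc a _ _)))

    countAfter≡0 : ∀ a i c h k u → (∀ v → path h (u ++ v) ≡ 0) → countAfter a i c h k u ≡ 0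
    countAfter≡0 a i c h k u path≗ = trans
      (∑-cong (words k) (λ {v} _ → cong (_*ℕ δ (a + majFrom i (c ∷ u ++ v))) (path≗ v)))
      (trans (∑-const (words k) 0) (*-zeroʳ (length (words k))))

    -- The exact equidistribution: the right side is free of `a`. The block with index `p` raises
    -- the accumulated value by `e + p` and leaves position, letter and height independent of `p`,
    -- so the sum over `p` is an instance of `∑-count`.
    ∑-blocks : ∀ a i c h k → ∑ blocks (countAfter a i c h k) ≡ paths k (pred m + h)
    ∑-blocks a i c h k = begin
      ∑ blocks (countAfter a i c h k)
        ≡⟨ ∑-map block (upTo m) _ ⟩
      ∑ (upTo m) (countAfter a i c h k ∘ block)
        ≡⟨ ∑-cong (upTo m) (λ {p} p∈ → single p (∈-upTo⁻ p∈)) ⟩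
      ∑ (upTo m) (λ p → count (a + e + p) (i + (3 + m)) 1F (pred m + h) k)
        ≡⟨ ∑-count (a + e) (i + (3 + m)) 1F (pred m + h) k ⟩
      paths k (pred m + h)  ∎
      where
      open ≡-Reasoning
      e = descent i c 0F + (2 + i)
      single : ∀ p → p < m → countAfter a i c h k (block p) ≡ count (a + e + p) (i + (3 + m)) 1F (pred m + h) k
      single p p<m = begin
        countAfter a i c h k (block p)
          ≡⟨ countAfter≡count a i c h {pred m + h} k (block p) (λ v → path-block h v p<m) ⟩
        count (a + majFrom i (c ∷ block p)) (i + length (block p)) (lastLetter c (block p)) (pred m + h) k
          ≡⟨ cong₂ (λ x y → count x (i + y) (lastLetter c (block p)) (pred m + h) k)
               (trans (cong (a +_) (majFrom-block i c p<m)) (sym (+-assoc a e p))) (length-block p<m) ⟩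
        count (a + e + p) (i + (3 + m)) (lastLetter c (block p)) (pred m + h) k
          ≡⟨ cong (λ x → count (a + e + p) (i + (3 + m)) x (pred m + h) k) (lastLetter-block c p) ⟩
        count (a + e + p) (i + (3 + m)) 1F (pred m + h) k  ∎

    -- Words that begin with a block contribute equally to both sides. Any other first piece either
    -- kills the path or shifts `a` and `a′` by the same amount and leads to common `i`, `c`, `h`,
    -- where the induction hypothesis applies. Each piece thus costs a factor of at most `d`, and
    -- the last `s` letters get the trivial bound `2 ^ s`.
    count-spread : ∀ K s a a′ i c h →
      count a i c h (K *ℕ (3 + m) + s) ≤ count a′ i c h (K *ℕ (3 + m) + s) + (2 ^ (3 + m) ∸ 1) ^ K *ℕ 2 ^ s
    count-spread zero s a a′ i c h = begin
      count a i c h s                     ≤⟨ count≤2^k a i c h s ⟩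
      2 ^ s                               ≤⟨ m≤n+m (2 ^ s) (count a′ i c h s) ⟩
      count a′ i c h s + 2 ^ s            ≡⟨ cong (count a′ i c h s +_) (+-identityʳ (2 ^ s)) ⟨
      count a′ i c h s + 1 *ℕ 2 ^ s        ∎
      where open ≤-Reasoning
    count-spread (suc K) s a a′ i c h = begin
      count a i c h (L + K *ℕ L + s)
        ≡⟨ decompose a ⟩
      paths k (pred m + h) + ∑ zs (countAfter a i c h k)
        ≤⟨ +-monoʳ-≤ (paths k (pred m + h)) (∑-mono-+ zs {g = countAfter a′ i c h k} b after) ⟩
      paths k (pred m + h) + (∑ zs (countAfter a′ i c h k) + length zs *ℕ b)
        ≤⟨ +-monoʳ-≤ (paths k (pred m + h)) (+-monoʳ-≤ (∑ zs (countAfter a′ i c h k)) (*-monoˡ-≤ b length-nonBlocks)) ⟩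
      paths k (pred m + h) + (∑ zs (countAfter a′ i c h k) + d *ℕ b)
        ≡⟨ +-assoc (paths k (pred m + h)) _ _ ⟨
      paths k (pred m + h) + ∑ zs (countAfter a′ i c h k) + d *ℕ b
        ≡⟨ cong₂ _+_ (decompose a′) (*-assoc d (d ^ K) (2 ^ s)) ⟨
      count a′ i c h (L + K *ℕ L + s) + d ^ suc K *ℕ 2 ^ s  ∎
      where
      open ≤-Reasoning
      L = 3 + m
      d = 2 ^ L ∸ 1
      k = K *ℕ L + s
      b = d ^ K *ℕ 2 ^ s
      zs = proj₁ nonBlocks
      decompose : ∀ a → count a i c h (L + K *ℕ L + s) ≡ paths k (pred m + h) + ∑ zs (countAfter a i c h k)
      decompose a = begin-equality
        count a i c h (L + K *ℕ L + s)       ≡⟨ cong (count a i c h) (+-assoc L (K *ℕ L) s) ⟩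
        count a i c h (L + k)               ≡⟨ ∑-words-+ L k _ ⟩
        ∑ (words L) (countAfter a i c h k)  ≡⟨ ∑-↭ (proj₂ nonBlocks) _ ⟩
        ∑ (blocks ++ zs) (countAfter a i c h k)
          ≡⟨ ∑-++ blocks zs _ ⟩
        ∑ blocks (countAfter a i c h k) + ∑ zs (countAfter a i c h k)
          ≡⟨ cong (_+ ∑ zs (countAfter a i c h k)) (∑-blocks a i c h k) ⟩
        paths k (pred m + h) + ∑ zs (countAfter a i c h k)  ∎
      after : ∀ u → countAfter a i c h k u ≤ countAfter a′ i c h k u + b
      after u with path-++ h u
      ... | inj₁ dead = ≤-trans (≤-reflexive (countAfter≡0 a i c h k u dead)) z≤n
      ... | inj₂ (h′ , alive) = begin
        countAfter a i c h k u
          ≡⟨ countAfter≡count a i c h {h′} k u alive ⟩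
        count (a + x) (i + length u) (lastLetter c u) h′ k
          ≤⟨ count-spread K s (a + x) (a′ + x) (i + length u) (lastLetter c u) h′ ⟩
        count (a′ + x) (i + length u) (lastLetter c u) h′ k + b
          ≡⟨ cong (_+ b) (countAfter≡count a′ i c h {h′} k u alive) ⟨
        countAfter a′ i c h k u + b  ∎
        where x = majFrom i (c ∷ u)

    majCount : ℕ → ℕ
    majCount n = length (filter (λ w → maj w % m ≟ r % m) (𝒞 n))

    majCount≡count : ∀ n → majCount n ≡ count 0 0 0F 0 (2 *ℕ n)
    majCount≡count n = begin
      majCount n
        ≡⟨ length-filter≡∑ _ (𝒞 n) ⟩
      ∑ (𝒞 n) (λ w → δ (maj w))
        ≡⟨ ∑-filter (isCatalan? n) (words (2 *ℕ n)) _ ⟩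
      ∑ (words (2 *ℕ n)) (λ w → ⟦ isCatalan? n w ⟧ *ℕ δ (maj w))
        ≡⟨ ∑-cong (words (2 *ℕ n)) (λ {w} w∈ → cong₂ (λ x y → x *ℕ δ y) (⟦isCatalan?⟧≡path n w∈) (maj≡majFrom-0F w)) ⟩
      count 0 0 0F 0 (2 *ℕ n)  ∎
      where open ≡-Reasoning

    error : ℕ → ℕ
    error n = (2 ^ (3 + m) ∸ 1) ^ ((2 *ℕ n) /ℕ (3 + m)) *ℕ 2 ^ ((2 *ℕ n) % (3 + m))

    module _ (n : ℕ) where
      private
        L K s : ℕ
        L = 3 + m
        K = (2 *ℕ n) /ℕ L
        s = (2 *ℕ n) % L
        2n≡ : 2 *ℕ n ≡ K *ℕ L + s
        2n≡ = trans (m≡m%n+[m/n]*n (2 *ℕ n) L) (+-comm s (K *ℕ L))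
        f : ℕ → ℕ
        f a = count a 0 0F 0 (2 *ℕ n)
        spread : ∀ a a′ → f a ≤ f a′ + error n
        spread a a′ = subst (λ k → count a 0 0F 0 k ≤ count a′ 0 0F 0 k + error n) (sym 2n≡)
                            (count-spread K s a a′ 0 0F 0)
        total : ∑ (upTo m) f ≡ length (𝒞 n)
        total = trans (∑-count 0 0 0F 0 (2 *ℕ n)) (sym (length-𝒞 n))
        constant : ∑ (upTo m) (λ _ → f 0) ≡ m *ℕ majCount n
        constant = trans (∑-const (upTo m) (f 0)) (cong₂ _*ℕ_ (length-upTo m) (sym (majCount≡count n)))

      -- An averaging argument: the counts for the starting values below `m` add up to the number of
      -- Catalan words, and each is within `error n` of the count for starting value 0, which is
      -- `majCount n`.
      m*majCount≤ : m *ℕ majCount n ≤ length (𝒞 n) + m *ℕ error n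
      m*majCount≤ = begin
        m *ℕ majCount n                        ≡⟨ constant ⟨
        ∑ (upTo m) (λ _ → f 0)                ≤⟨ ∑-mono-+ (upTo m) {g = f} (error n) (λ a → spread 0 a) ⟩
        ∑ (upTo m) f + length (upTo m) *ℕ error n    ≡⟨ cong₂ (λ x y → x + y *ℕ error n) total (length-upTo m) ⟩
        length (𝒞 n) + m *ℕ error n                  ∎
        where open ≤-Reasoning

      length-𝒞≤ : length (𝒞 n) ≤ m *ℕ majCount n + m *ℕ error n
      length-𝒞≤ = begin
        length (𝒞 n)                          ≡⟨ total ⟨
        ∑ (upTo m) f                          ≤⟨ ∑-mono-+ (upTo m) {g = λ _ → f 0} (error n) (λ a → spread a 0) ⟩
        ∑ (upTo m) (λ _ → f 0) + length (upTo m) *ℕ error n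
                                              ≡⟨ cong₂ (λ x y → x + y *ℕ error n) constant (length-upTo m) ⟩
        m *ℕ majCount n + m *ℕ error n                ∎
        where open ≤-Reasoning

-- Exponential growth against polynomial growth.

-- Bernoulli's inequality `(1 + 1/d)^t ≥ 1 + t/d` with denominators cleared.
bernoulli : ∀ d t → (d + t) *ℕ d ^ t ≤ d *ℕ suc d ^ t
bernoulli d zero    = ≤-reflexive (cong (_*ℕ 1) (+-identityʳ d))
bernoulli d (suc t) = begin
  (d + suc t) *ℕ (d *ℕ d ^ t)               ≤⟨ m+n≤o⇒m≤o _ (≤-reflexive (expand d t (d ^ t))) ⟩
  suc d *ℕ ((d + t) *ℕ d ^ t)               ≤⟨ *-monoʳ-≤ (suc d) (bernoulli d t) ⟩
  suc d *ℕ (d *ℕ suc d ^ t)                 ≡⟨ swap (suc d) d (suc d ^ t) ⟩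
  d *ℕ (suc d *ℕ suc d ^ t)                 ∎
  where
  open ≤-Reasoning
  expand : ∀ d t x → (d + suc t) *ℕ (d *ℕ x) + t *ℕ x ≡ suc d *ℕ ((d + t) *ℕ x)
  expand = solve-∀
  swap : ∀ a b c → a *ℕ (b *ℕ c) ≡ b *ℕ (a *ℕ c)
  swap = solve-∀

^-distribʳ-* : ∀ a b n → (a *ℕ b) ^ n ≡ a ^ n *ℕ b ^ n
^-distribʳ-* a b zero    = refl
^-distribʳ-* a b (suc n) = trans (cong (a *ℕ b *ℕ_) (^-distribʳ-* a b n)) (interchange a b (a ^ n) (b ^ n))
  where
  interchange : ∀ a b x y → a *ℕ b *ℕ (x *ℕ y) ≡ a *ℕ x *ℕ (b *ℕ y)
  interchange = solve-∀

-- The 9 comes from `(1 + K)² ≤ 9(d + t)²`, the `d ^ 3` from cubing Bernoulli's inequality, and the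
-- final 3 from `t = ⌊K/3⌋`. Together they ensure `9 * d ^ 3 * M < d + t`.
threshold : ℕ → ℕ → ℕ
threshold d M = 9 *ℕ d ^ 3 *ℕ M *ℕ 3

-- With t = ⌊K/3⌋, the cube of Bernoulli's inequality gives a factor of
-- order t³, which beats (1 + K)².
quadratic<exponential : ∀ d .{{_ : NonZero d}} M K → threshold d M ≤ K →
                        M *ℕ (suc K *ℕ suc K) *ℕ d ^ K < suc d ^ K
quadratic<exponential d M K N≤K = *-cancelˡ-< (d ^ 3) _ _ (begin-strict
  d ^ 3 *ℕ (M *ℕ (suc K *ℕ suc K) *ℕ d ^ K)
    ≡⟨ *-assoc (d ^ 3) _ (d ^ K) ⟨
  d ^ 3 *ℕ (M *ℕ (suc K *ℕ suc K)) *ℕ d ^ K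
    <⟨ *-monoˡ-< (d ^ K) {{m^n≢0 d K}} polynomial ⟩
  (d + t) ^ 3 *ℕ d ^ K
    ≡⟨ cong ((d + t) ^ 3 *ℕ_) (split d) ⟩
  (d + t) ^ 3 *ℕ (d ^ s *ℕ (d ^ t) ^ 3)
    ≡⟨ swap ((d + t) ^ 3) (d ^ s) _ ⟩
  d ^ s *ℕ ((d + t) ^ 3 *ℕ (d ^ t) ^ 3)
    ≡⟨ cong (d ^ s *ℕ_) (^-distribʳ-* (d + t) (d ^ t) 3) ⟨
  d ^ s *ℕ ((d + t) *ℕ d ^ t) ^ 3
    ≤⟨ *-mono-≤ (^-monoˡ-≤ s (n≤1+n d)) (^-monoˡ-≤ 3 (bernoulli d t)) ⟩
  suc d ^ s *ℕ (d *ℕ suc d ^ t) ^ 3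
    ≡⟨ cong (suc d ^ s *ℕ_) (^-distribʳ-* d (suc d ^ t) 3) ⟩
  suc d ^ s *ℕ (d ^ 3 *ℕ (suc d ^ t) ^ 3)
    ≡⟨ swap (suc d ^ s) (d ^ 3) _ ⟩
  d ^ 3 *ℕ (suc d ^ s *ℕ (suc d ^ t) ^ 3)
    ≡⟨ cong (d ^ 3 *ℕ_) (split (suc d)) ⟨
  d ^ 3 *ℕ suc d ^ K  ∎)
  where
  open ≤-Reasoning
  t s : ℕ
  t = K /ℕ 3
  s = K % 3
  K≡ : K ≡ s + t *ℕ 3
  K≡ = m≡m%n+[m/n]*n K 3
  split : ∀ x → x ^ K ≡ x ^ s *ℕ (x ^ t) ^ 3
  split x = trans (cong (x ^_) K≡)
           (trans (^-distribˡ-+-* x s (t *ℕ 3)) (cong (x ^ s *ℕ_) (sym (^-*-assoc x t 3))))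
  swap : ∀ a b c → a *ℕ (b *ℕ c) ≡ b *ℕ (a *ℕ c)
  swap = solve-∀
  1+K≤ : suc K ≤ 3 *ℕ (d + t)
  1+K≤ = begin
    suc K            ≡⟨ cong suc K≡ ⟩
    suc s + t *ℕ 3    ≤⟨ +-monoˡ-≤ (t *ℕ 3) (m%n<n K 3) ⟩
    3 + t *ℕ 3        ≡⟨ *-comm (suc t) 3 ⟩
    3 *ℕ suc t        ≤⟨ *-monoʳ-≤ 3 (+-monoˡ-≤ t (>-nonZero⁻¹ d)) ⟩
    3 *ℕ (d + t)      ∎
  large : 9 *ℕ d ^ 3 *ℕ M < d + t
  large = begin-strict
    9 *ℕ d ^ 3 *ℕ M            ≡⟨ m*n/n≡m (9 *ℕ d ^ 3 *ℕ M) 3 ⟨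
    9 *ℕ d ^ 3 *ℕ M *ℕ 3 /ℕ 3    ≤⟨ /-monoˡ-≤ 3 N≤K ⟩
    t                        <⟨ m<n+m t (>-nonZero⁻¹ d) ⟩
    d + t                    ∎
  instance
    d+t≢0 : NonZero (d + t)
    d+t≢0 = >-nonZero (≤-<-trans z≤n large)
  polynomial : d ^ 3 *ℕ (M *ℕ (suc K *ℕ suc K)) < (d + t) ^ 3
  polynomial = begin-strict
    d ^ 3 *ℕ (M *ℕ (suc K *ℕ suc K))
      ≤⟨ *-monoʳ-≤ (d ^ 3) (*-monoʳ-≤ M (*-mono-≤ 1+K≤ 1+K≤)) ⟩
    d ^ 3 *ℕ (M *ℕ (3 *ℕ (d + t) *ℕ (3 *ℕ (d + t))))
      ≡⟨ regroup (d ^ 3) M (d + t) ⟩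
    9 *ℕ d ^ 3 *ℕ M *ℕ ((d + t) *ℕ (d + t))
      <⟨ *-monoˡ-< ((d + t) *ℕ (d + t)) {{m*n≢0 (d + t) (d + t)}} large ⟩
    (d + t) *ℕ ((d + t) *ℕ (d + t))
      ≡⟨ cong (λ x → (d + t) *ℕ ((d + t) *ℕ x)) (*-identityʳ (d + t)) ⟨
    (d + t) ^ 3  ∎
    where
    regroup : ∀ x M y → x *ℕ (M *ℕ (3 *ℕ y *ℕ (3 *ℕ y))) ≡ 9 *ℕ x *ℕ M *ℕ (y *ℕ y)
    regroup = solve-∀

-- Passage to rational limits.

-- Opened only here: +_ clashes with sections of _+_ on ℕ.
open import Data.Integer as ℤ using (ℤ; +_; -[1+_])

∣m⊖n∣≤ : ∀ {m n b} → m ≤ n + b → n ≤ m + b → ℤ.∣ m ℤ.⊖ n ∣ ≤ b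
∣m⊖n∣≤ {m} {n} {b} m≤ n≤ with ≤-total m n
... | inj₁ m≤n = begin
  ℤ.∣ m ℤ.⊖ n ∣  ≡⟨ ℤ.∣⊖∣-≤ m≤n ⟩
  n ∸ m          ≤⟨ m≤n+o⇒m∸n≤o n m n≤ ⟩
  b              ∎
  where open ≤-Reasoning
... | inj₂ n≤m = begin
  ℤ.∣ m ℤ.⊖ n ∣  ≡⟨ ℤ.∣m⊖n∣≡∣n⊖m∣ m n ⟩
  ℤ.∣ n ℤ.⊖ m ∣  ≡⟨ ℤ.∣⊖∣-≤ n≤m ⟩
  m ∸ n          ≤⟨ m≤n+o⇒m∸n≤o m n m≤ ⟩
  b              ∎
  where open ≤-Reasoning

-- The difference is `|mc - t| / (tm)`, hence at most `b/t`, which is below `1/q` for the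
-- denominator `q` of `ε`; and `1/q ≤ ε` because a positive `ε` has numerator at least 1.
∣c/t-1/m∣<ε : ∀ c t m .{{_ : NonZero t}} .{{_ : NonZero m}} b ε → 0ℚ ℚ.< ε →
  m *ℕ c ≤ t + m *ℕ b → t ≤ m *ℕ c + m *ℕ b → ℚ.↧ₙ ε *ℕ b < t →
  ℚ.∣ (+ c ℚ./ t) ℚ.- (+ 1 ℚ./ m) ∣ ℚ.< ε
∣c/t-1/m∣<ε c t m b (mkℚ (+ 0) _ _) (ℚ.*<* (ℤ.+<+ ()))
∣c/t-1/m∣<ε c t m b (mkℚ -[1+ _ ] _ _) (ℚ.*<* ())
∣c/t-1/m∣<ε c t@(suc t-1) m@(suc m-1) b ε@(mkℚ (+ suc p-1) q-1 _) _ mc≤ t≤ qb<t =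
  ℚ.toℚᵘ-cancel-< (ℚᵘ.<-respˡ-≃ (ℚᵘ.≃-sym unnormalise) (ℚᵘ.*<* (begin-strict
    + ℤ.∣ z ∣ ℤ.* + q                ≡⟨ ℤ.pos-* ℤ.∣ z ∣ q ⟨
    + (ℤ.∣ z ∣ *ℕ q)                  <⟨ ℤ.+<+ bound ⟩
    + (p *ℕ (t *ℕ m))                  ≡⟨ ℤ.pos-* p (t *ℕ m) ⟩
    + p ℤ.* + (t *ℕ m)                ∎)))
  where
  open ℤ.≤-Reasoning
  p q : ℕ
  p = suc p-1
  q = suc q-1
  z : ℤ
  z = + c ℤ.* + m ℤ.+ (ℤ.- + 1) ℤ.* + t
  -- With `t` and `m` matched as successors, the two fractions are definitionally `fromℚᵘ x` and
  -- `fromℚᵘ y`, so the estimate can be carried out on unnormalised fractions.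
  x y : ℚᵘ.ℚᵘ
  x = ℚᵘ.mkℚᵘ (+ c) t-1
  y = ℚᵘ.mkℚᵘ (+ 1) m-1
  unnormalise : ℚ.toℚᵘ ℚ.∣ ℚ.fromℚᵘ x ℚ.- ℚ.fromℚᵘ y ∣ ℚᵘ.≃ ℚᵘ.∣ x ℚᵘ.- y ∣
  unnormalise = ℚᵘ.≃-trans (ℚ.toℚᵘ-homo-∣-∣ (ℚ.fromℚᵘ x ℚ.- ℚ.fromℚᵘ y)) (ℚᵘ.∣-∣-cong
    (ℚᵘ.≃-trans (ℚ.toℚᵘ-homo-+ (ℚ.fromℚᵘ x) (ℚ.- ℚ.fromℚᵘ y)) (ℚᵘ.+-cong (ℚ.toℚᵘ-fromℚᵘ x)
      (ℚᵘ.≃-trans (ℚ.toℚᵘ-homo‿- (ℚ.fromℚᵘ y)) (ℚᵘ.-‿cong (ℚ.toℚᵘ-fromℚᵘ y))))))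
  z≡ : z ≡ m *ℕ c ℤ.⊖ t
  z≡ = trans (cong₂ ℤ._+_ (trans (sym (ℤ.pos-* c m)) (cong +_ (*-comm c m))) (ℤ.-1*i≡-i (+ t)))
             (ℤ.m-n≡m⊖n (m *ℕ c) t)
  bound : ℤ.∣ z ∣ *ℕ q < p *ℕ (t *ℕ m)
  bound = ≤.begin-strict
    ℤ.∣ z ∣ *ℕ q         ≤.≤⟨ *-monoˡ-≤ q (subst (λ i → ℤ.∣ i ∣ ≤ m *ℕ b) (sym z≡) (∣m⊖n∣≤ mc≤ t≤)) ⟩
    m *ℕ b *ℕ q           ≤.≡⟨ regroup m b q ⟩
    q *ℕ b *ℕ m           ≤.<⟨ *-monoˡ-< m qb<t ⟩
    t *ℕ m               ≤.≤⟨ m≤n*m (t *ℕ m) p ⟩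
    p *ℕ (t *ℕ m)         ≤.∎
    where
    module ≤ = ≤-Reasoning
    regroup : ∀ m b q → m *ℕ b *ℕ q ≡ q *ℕ b *ℕ m
    regroup = solve-∀

/1-cancel : ∀ k c C → suc k *ℕ c ≡ C → + c ℚ./ 1 ≡ (+ 1 ℚ./ suc k) ℚ.* (+ C ℚ./ 1)
/1-cancel k c C refl = ℚ.toℚᵘ-injective (ℚᵘ.≃-trans (ℚ.toℚᵘ-fromℚᵘ x)
  (ℚᵘ.≃-trans (ℚᵘ.*≡* cross) (ℚᵘ.≃-sym
    (ℚᵘ.≃-trans (ℚ.toℚᵘ-homo-* (ℚ.fromℚᵘ y) (ℚ.fromℚᵘ w))
                (ℚᵘ.*-cong (ℚ.toℚᵘ-fromℚᵘ y) (ℚ.toℚᵘ-fromℚᵘ w))))))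
  where
  x y w : ℚᵘ.ℚᵘ
  x = ℚᵘ.mkℚᵘ (+ c) 0
  y = ℚᵘ.mkℚᵘ (+ 1) k
  w = ℚᵘ.mkℚᵘ (+ (suc k *ℕ c)) 0
  cross : + c ℤ.* + (suc k *ℕ 1) ≡ + 1 ℤ.* + (suc k *ℕ c) ℤ.* + 1
  cross = begin
    + c ℤ.* + (suc k *ℕ 1)              ≡⟨ ℤ.pos-* c (suc k *ℕ 1) ⟨
    + (c *ℕ (suc k *ℕ 1))                ≡⟨ cong +_ (regroup c k) ⟩
    + (1 *ℕ (suc k *ℕ c) *ℕ 1)            ≡⟨ ℤ.pos-* (1 *ℕ (suc k *ℕ c)) 1 ⟩
    + (1 *ℕ (suc k *ℕ c)) ℤ.* + 1        ≡⟨ cong (ℤ._* + 1) (ℤ.pos-* 1 (suc k *ℕ c)) ⟩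
    + 1 ℤ.* + (suc k *ℕ c) ℤ.* + 1      ∎
    where
    open ≡-Reasoning
    regroup : ∀ c k → c *ℕ (suc k *ℕ 1) ≡ 1 *ℕ (suc k *ℕ c) *ℕ 1
    regroup = solve-∀

-- Since `n + 1 ≤ L(K + 1)`, the polynomial loss `(n + 1)²` in the Catalan lower bound is at most
-- `L²(K + 1)²`, whence the multiplier `q * L²`. The extra factor `L` in the hypothesis turns a
-- bound on `n` into one on `K = ⌊2n/L⌋`.
q*error<length-𝒞 : ∀ m .{{_ : NonZero m}} r q n →
  threshold (2 ^ (3 + m) ∸ 1) (q *ℕ ((3 + m) *ℕ (3 + m))) *ℕ (3 + m) ≤ n →
  q *ℕ error m r n < length (𝒞 n)
q*error<length-𝒞 m r q n N≤n = *-cancelˡ-< (suc n *ℕ suc n) _ _ (begin-strict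
  suc n *ℕ suc n *ℕ (q *ℕ (d ^ K *ℕ 2 ^ s))
    ≤⟨ *-monoˡ-≤ (q *ℕ (d ^ K *ℕ 2 ^ s)) (*-mono-≤ 1+n≤ 1+n≤) ⟩
  L *ℕ suc K *ℕ (L *ℕ suc K) *ℕ (q *ℕ (d ^ K *ℕ 2 ^ s))
    ≡⟨ regroup L (suc K) q (d ^ K) (2 ^ s) ⟩
  q *ℕ (L *ℕ L) *ℕ (suc K *ℕ suc K) *ℕ d ^ K *ℕ 2 ^ s
    <⟨ *-monoˡ-< (2 ^ s) {{m^n≢0 2 s}} (quadratic<exponential d (q *ℕ (L *ℕ L)) K N≤K) ⟩
  suc d ^ K *ℕ 2 ^ s
    ≡⟨ cong (λ x → x ^ K *ℕ 2 ^ s) 1+d≡ ⟩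
  (2 ^ L) ^ K *ℕ 2 ^ s
    ≡⟨ cong (_*ℕ 2 ^ s) (trans (^-*-assoc 2 L K) (cong (2 ^_) (*-comm L K))) ⟩
  2 ^ (K *ℕ L) *ℕ 2 ^ s
    ≡⟨ ^-distribˡ-+-* 2 (K *ℕ L) s ⟨
  2 ^ (K *ℕ L + s)
    ≡⟨ cong (2 ^_) (trans 2n≡ (+-comm s (K *ℕ L))) ⟨
  2 ^ (2 *ℕ n)
    ≤⟨ 4^n≤[1+n]²*length-𝒞 n ⟩
  suc n *ℕ suc n *ℕ length (𝒞 n)  ∎)
  where
  open ≤-Reasoning
  L d K s : ℕ
  L = 3 + m
  d = 2 ^ L ∸ 1
  K = (2 *ℕ n) /ℕ L
  s = (2 *ℕ n) % L
  1+d≡ : suc d ≡ 2 ^ L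
  1+d≡ = suc-pred (2 ^ L) {{m^n≢0 2 L}}
  instance
    d≢0 : NonZero d
    d≢0 = >-nonZero (s≤s⁻¹ (subst (2 ≤_) (sym 1+d≡) (*-monoʳ-≤ 2 (m^n>0 2 (2 + m)))))
  2n≡ : 2 *ℕ n ≡ s + K *ℕ L
  2n≡ = m≡m%n+[m/n]*n (2 *ℕ n) L
  1+n≤ : suc n ≤ L *ℕ suc K
  1+n≤ = begin
    suc n          ≤⟨ s≤s (m≤m+n n (n + 0)) ⟩
    suc (2 *ℕ n)    ≡⟨ cong suc 2n≡ ⟩
    suc s + K *ℕ L  ≤⟨ +-monoˡ-≤ (K *ℕ L) (m%n<n (2 *ℕ n) L) ⟩
    suc K *ℕ L      ≡⟨ *-comm (suc K) L ⟩
    L *ℕ suc K      ∎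
  N≤K : threshold d (q *ℕ (L *ℕ L)) ≤ K
  N≤K = begin
    threshold d (q *ℕ (L *ℕ L))          ≡⟨ m*n/n≡m (threshold d (q *ℕ (L *ℕ L))) L ⟨
    threshold d (q *ℕ (L *ℕ L)) *ℕ L /ℕ L  ≤⟨ /-monoˡ-≤ L (≤-trans N≤n (m≤m+n n (n + 0))) ⟩
    K                                  ∎
  regroup : ∀ L k q x y → L *ℕ k *ℕ (L *ℕ k) *ℕ (q *ℕ (x *ℕ y)) ≡ q *ℕ (L *ℕ L) *ℕ (k *ℕ k) *ℕ x *ℕ y
  regroup = solve-∀

theorem3 : (∀ (n : ℕ) → + length (𝒞 n) / 1 ≡ (+ 1 / suc n) * (+ ((2 *ℕ n) C n) / 1))
    × Balanced 𝒞 𝒞-nonEmpty maj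
theorem3 = (λ n → /1-cancel n (length (𝒞 n)) ((2 *ℕ n) C n) (catalan-number n)) ,
  -- The witness depends on `ε` only through its denominator and is uniform in `r`.
  λ m _ r _ ε 0<ε → threshold (2 ^ (3 + m) ∸ 1) (ℚ.↧ₙ ε *ℕ ((3 + m) *ℕ (3 + m))) *ℕ (3 + m) ,
    λ n N≤n → ∣c/t-1/m∣<ε (majCount m r n) (length (𝒞 n)) m {{𝒞-nonEmpty n}} (error m r n) ε 0<ε
      (m*majCount≤ m r n) (length-𝒞≤ m r n) (q*error<length-𝒞 m r (ℚ.↧ₙ ε) n N≤n)
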